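{- Let $k\ge 2$ be an integer. The communication complexity of constructing a $+k$-spanner of an unweighted undirected distributed graph on $n$ vertices with edges observed at $s$ sites in the blackboard model, with or without duplication, is $\tilde{O}(s+n\sqrt{n+s})$.
   Context: Distributed graph: there are $s$ sites $S_1,\dots,S_s$; all know the common vertex set $V$, $|V|=n$, and site $S_i$ holds a subset $E_i\subseteq E$ of the edges of an undirected graph $G=(V,E)$, where $E=\bigcup_{i=1}^s E_i$. In the setting without duplication the sets $E_i$ are pairwise disjoint; in the duplication setting they may intersect. Blackboard model: sites communicate by writing messages on a shared blackboard (a broadcast channel) visible to all sites and to a coordinator, who must output the result. The communication cost of a protocol is the total number of bits communicated; the communication complexity of a problem is the least communication cost of a (randomized, with success probability $1-o(1)$) protocol solving it. Spanner: a $+k$-spanner of $G$ is a subgraph $H=(V,E')$, $E'\subseteq E$, with $d_H(u,v)\le d_G(u,v)+k$ for all $u,v\in V$, where $d$ denotes shortest-path distance. $\tilde{O}(f)$ denotes $f$ times a polylogarithmic factor (in $n$ and $s$). -}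

module Defs where

open import Data.Bool using (Bool; true; false; T)
open import Data.Fin using (Fin; zero; suc; finToFun)
open import Data.Fin.Subset using (Subset; _∉_; ∣_∣)
open import Data.Nat using (ℕ; zero; suc; _+_; _*_; _∸_; _^_; _≤_)
open import Data.Nat.Logarithm using (⌈log₂_⌉)
open import Data.Product using (Σ; ∃; ∃₂; _×_; _,_)
open import Data.Unit using (⊤)
open import Function.Bundles using (_⇔_)
open import Relation.Binary.PropositionalEquality using (_≡_; _≢_)
open import Relation.Nullary using (¬_)

-- Simple undirected graphs on the vertex set Fin n.  The same type serves for
-- the edge sets E_i held by the sites, since the vertex set is common.
record Graph (n : ℕ) : Set where
  field
    adjacent    : Fin n → Fin n → Bool
    symmetric   : ∀ u v → adjacent u v ≡ adjacent v u
    irreflexive : ∀ u → adjacent u u ≡ false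

  Adj : Fin n → Fin n → Set
  Adj u v = T (adjacent u v)

open Graph public using (Adj)

data Walk {n} (G : Graph n) : ℕ → Fin n → Fin n → Set where
  here : ∀ {u} → Walk G 0 u u
  step : ∀ {ℓ u v w} → Adj G u v → Walk G ℓ v w → Walk G (suc ℓ) u w

-- d_G(u,v) = d for a finite d; an infinite distance is the absence of any d.
Distance : ∀ {n} → Graph n → Fin n → Fin n → ℕ → Set
Distance G u v d = Walk G d u v × (∀ ℓ → Walk G ℓ u v → d ≤ ℓ)

_⊆ᴳ_ : ∀ {n} → Graph n → Graph n → Set
H ⊆ᴳ G = ∀ u v → Adj H u v → Adj G u v

-- d_H(u,v) ≤ d_G(u,v) + k is vacuous when d_G(u,v) is infinite, and forces
-- d_H(u,v) to be finite otherwise.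
IsAdditiveSpanner : ℕ → ∀ {n} → Graph n → Graph n → Set
IsAdditiveSpanner k G H =
  H ⊆ᴳ G ×
  (∀ u v d → Distance G u v d → ∃ λ d′ → Distance H u v d′ × d′ ≤ d + k)

record DistributedGraph (n s : ℕ) : Set where
  field
    graph : Graph n
    site  : Fin s → Graph n
    union : ∀ u v → Adj graph u v ⇔ (∃ λ i → Adj (site i) u v)

open DistributedGraph public

data Setting : Set where
  withDuplication withoutDuplication : Setting

Admissible : Setting → ∀ {n s} → DistributedGraph n s → Set
Admissible withDuplication    D = ⊤
Admissible withoutDuplication D =
  ∀ i j → i ≢ j → ∀ u v → ¬ (Adj (site D i) u v × Adj (site D j) u v)

-- A position in the tree is a content of the blackboard.  It determines who
-- writes the next bit; that bit depends on the writer's local data and, through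
-- the position, on everything written so far.  A site with nothing to report
-- must still pay for the bits saying so.  At a leaf the coordinator, who has no
-- input, computes the result from the blackboard and its own data.
data Protocol (s : ℕ) (Local Coord Out : Set) : Set where
  output : (Coord → Out) → Protocol s Local Coord Out
  write  : Fin s → (Local → Bool) → (Bool → Protocol s Local Coord Out) →
           Protocol s Local Coord Out

module _ {s : ℕ} {Local Coord Out : Set} where

  result : Protocol s Local Coord Out → (Fin s → Local) → Coord → Out
  result (output f)     x c = f c
  result (write i b next) x c = result (next (b (x i))) x c

  bits : Protocol s Local Coord Out → (Fin s → Local) → ℕ
  bits (output f)     x = 0
  bits (write i b next) x = suc (bits (next (b (x i))) x)

-- Coins are private: the coordinator (index zero) and each site i (index suc i)
-- toss `coins` fair coins independently, so an outcome of the whole experiment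
-- is a uniformly random element of Fin ((2 ^ coins) ^ suc s), decoded into the
-- individual seeds by finToFun.
record RandomizedProtocol (n s : ℕ) : Set where
  field
    coins    : ℕ
    protocol : Protocol s (Graph n × Fin (2 ^ coins)) (Fin (2 ^ coins)) (Graph n)

  outcomes : ℕ
  outcomes = (2 ^ coins) ^ suc s

  seed : Fin outcomes → Fin (suc s) → Fin (2 ^ coins)
  seed = finToFun

  localData : DistributedGraph n s → Fin outcomes →
              Fin s → Graph n × Fin (2 ^ coins)
  localData D ω i = site D i , seed ω (suc i)

  answer : DistributedGraph n s → Fin outcomes → Graph n
  answer D ω = result protocol (localData D ω) (seed ω zero)

  cost : DistributedGraph n s → Fin outcomes → ℕ
  cost D ω = bits protocol (localData D ω)

open RandomizedProtocol public using (outcomes; answer; cost)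

-- A graph construction problem: which outputs H are correct for the graph G.
Problem : Set₁
Problem = ∀ {n} → Graph n → Graph n → Set

-- On input D the protocol errs with probability at most 1/q: all erroneous
-- outcomes lie in a set whose share of the outcomes is at most 1/q.
ErrorAtMost1/ : ℕ → Problem → ∀ {n s} →
                RandomizedProtocol n s → DistributedGraph n s → Set
ErrorAtMost1/ q P Π D =
  Σ (Subset (outcomes Π)) λ bad →
    (∀ ω → ω ∉ bad → P (graph D) (answer Π D ω)) × q * ∣ bad ∣ ≤ outcomes Π

-- Worst-case success probability 1 - o(1) as n → ∞, uniformly in s.
SolvesWhp : Setting → Problem → (∀ n s → RandomizedProtocol n s) → Set
SolvesWhp σ P Π =
  ∀ q → ∃ λ n₀ → ∀ n s → n₀ ≤ n → (D : DistributedGraph n s) →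
  Admissible σ D → ErrorAtMost1/ q P (Π n s) D

-- `Bound n s t` says that t is within the bound for parameters n and s.  The
-- least cost of a protocol is within an upper bound iff some protocol's worst-case
-- cost (over inputs and coins) is.
CommunicationComplexityWithin :
  Setting → Problem → (Bound : ℕ → ℕ → ℕ → Set) → Set
CommunicationComplexityWithin σ P Bound =
  Σ (∀ n s → RandomizedProtocol n s) λ Π →
    SolvesWhp σ P Π ×
    (∀ n s (D : DistributedGraph n s) → Admissible σ D →
     ∀ ω → Bound n s (cost (Π n s) D ω))

-- The real inequality t ≤ a + b √m: for naturals it holds iff t ≤ a or
-- (t - a)² ≤ b² m, and truncated subtraction covers both cases.
_≤_+_√_ : ℕ → ℕ → ℕ → ℕ → Set
t ≤ a + b √ m = (t ∸ a) ^ 2 ≤ b ^ 2 * m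

-- The shift by 2 keeps the logarithm positive.
polylog : (C c n s : ℕ) → ℕ
polylog C c n s = C * ⌈log₂ (2 + n + s) ⌉ ^ c

-- The communication complexity is Õ(a + b √m), with a, b, m functions of n, s.
CommunicationComplexityÕ :
  Setting → Problem → (a b m : ℕ → ℕ → ℕ) → Set
CommunicationComplexityÕ σ P a b m =
  ∃₂ λ C c → CommunicationComplexityWithin σ P λ n s t →
    t ≤ polylog C c n s * a n s + polylog C c n s * b n s √ m n s

{-# OPTIONS --safe #-}

-- The protocol is deterministic.  Let d = ⌊√(n + s)⌋.  In a round the sites take
-- turns; each posts those of its edges that are wanted given the blackboard, then
-- passes with one bit, so a round costs s bits plus O(log (n + s)) per posted edge.
--
-- A first round posts edges at vertices of current degree below d.  Afterwards a
-- vertex has all its edges on the blackboard or has degree at least d there.  The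
-- neighbourhoods of the latter vertices have a hitting set R of size O(d log (n + s)),
-- which everybody computes greedily from the blackboard.  If all breadth-first
-- distances from R are then realised on the blackboard, it holds a +2-spanner.
--
-- The searches from all roots in R run in parallel.  A level without vertices of
-- degree at least d needs no communication.  Every other level is processed in a
-- block of three rounds together with its two successors; each such block adds d
-- newly reached vertices, so n/d + 1 blocks suffice.  A posted edge brings
-- some vertex within reach of the level that follows the processed one, for some
-- root; as levels only increase, this happens at most once for every root and vertex,
-- so these rounds post at most |R| n edges.
module Submission where

open import Defs
open import Algebra.Properties.Semiring.Sum as ΣSum using ()
open import Data.Bool using (Bool; not; true; false; T; T?; _∨_)
open import Data.Bool.Properties using (T-∨)
open import Data.Empty using (⊥)
open import Data.Fin using (Fin; zero; suc; toℕ; combine; remQuot; inject≤; fromℕ<)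
open import Data.Fin.Properties
  using (any?; _≟_; toℕ<n; combine-remQuot; remQuot-combine; toℕ-inject≤;
         toℕ-injective; toℕ-fromℕ<)
open import Data.Fin.Subset.Properties using (∣⊥∣≡0)
import Data.Fin.Subset as Subset
open import Data.List
  using (List; []; _∷_; length; lookup; allFin; drop; null; cartesianProduct)
open import Data.List.Membership.Propositional using (_∈_)
open import Data.List.Membership.Propositional.Properties
  using (∈-allFin; ∈-cartesianProduct⁺)
open import Data.List.Properties using (length-tabulate)
open import Data.List.Relation.Unary.Any as Any using (Any; here; there)
open import Data.List.Relation.Unary.Any.Properties using (lookup-index)
open import Data.Nat
  using (ℕ; zero; suc; _+_; _*_; _∸_; _^_; _≤_; _<_; _⊓_; z≤n; s≤s; s≤s⁻¹; _/_; _%_;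
         _≤?_; _<?_; ⌊_/2⌋; ⌈_/2⌉)
open import Data.Nat.DivMod using (m≡m%n+[m/n]*n; m%n<n; m/n*n≤m)
open import Data.Nat.Induction using (<-rec)
open import Data.Nat.Logarithm using (⌈log₂_⌉; ⌈log₂⌉-mono-≤; ⌈log₂⌈n/2⌉⌉≡⌈log₂n⌉∸1)
open import Data.Nat.Properties hiding (_≟_)
open import Data.Nat.Tactic.RingSolver using (solve-∀)
open import Data.Product using (Σ; ∃; ∃₂; _×_; _,_; proj₁; proj₂; map; map₂)
open import Data.Sum as Sum using (_⊎_; inj₁; inj₂; [_,_]′)
open import Function using (_∘_; id)
open import Function.Bundles using (Equivalence)
open import Relation.Binary.PropositionalEquality
  using (_≡_; _≢_; refl; sym; trans; cong; cong₂; subst; subst-subst-sym)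
open import Relation.Nullary using (¬_; Dec; yes; no; contradiction)
open import Relation.Nullary.Decidable
  using (⌊_⌋; map′; toWitness; fromWitness; ¬?; _×-dec_; _⊎-dec_; decidable-stable;
         toSum)

open ΣSum +-*-semiring using (sum; ∑-comm; ∑-distrib-+; *-distribʳ-sum)

-- Sums, maxima and counting over finite index sets

sum-mono-≤ : ∀ {n} {f g : Fin n → ℕ} → (∀ i → f i ≤ g i) → sum f ≤ sum g
sum-mono-≤ {zero}  f≤g = z≤n
sum-mono-≤ {suc n} f≤g = +-mono-≤ (f≤g zero) (sum-mono-≤ (f≤g ∘ suc))

sum-mono-< : ∀ {n} {f g : Fin n → ℕ} → (∀ i → f i ≤ g i) →
             ∀ i → f i < g i → sum f < sum g
sum-mono-< f≤g zero    lt = +-mono-<-≤ lt (sum-mono-≤ (f≤g ∘ suc))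
sum-mono-< f≤g (suc i) lt = +-mono-≤-< (f≤g zero) (sum-mono-< (f≤g ∘ suc) i lt)

sum-≤-const : ∀ {n k} {f : Fin n → ℕ} → (∀ i → f i ≤ k) → sum f ≤ n * k
sum-≤-const {zero}  f≤k = z≤n
sum-≤-const {suc n} f≤k = +-mono-≤ (f≤k zero) (sum-≤-const (f≤k ∘ suc))

maximum : ∀ {n} (f : Fin (suc n) → ℕ) → ∃ λ i → ∀ j → f j ≤ f i
maximum {zero}  f = zero , λ { zero → ≤-refl }
maximum {suc n} f with maximum (f ∘ suc)
... | i , max with ≤-total (f zero) (f (suc i))
... | inj₁ le = suc i , λ { zero → le ; (suc j) → max j }
... | inj₂ ge = zero , λ { zero → ≤-refl ; (suc j) → ≤-trans (max j) ge }

indicator : {P : Set} → Dec P → ℕ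
indicator (yes _) = 1
indicator (no  _) = 0

indicator≤1 : {P : Set} (P? : Dec P) → indicator P? ≤ 1
indicator≤1 (yes _) = ≤-refl
indicator≤1 (no  _) = z≤n

indicator-mono : {P Q : Set} (P? : Dec P) (Q? : Dec Q) → (P → Q) →
                 indicator P? ≤ indicator Q?
indicator-mono (yes p) (yes q) P⇒Q = ≤-refl
indicator-mono (yes p) (no ¬q) P⇒Q = contradiction (P⇒Q p) ¬q
indicator-mono (no ¬p) Q?      P⇒Q = z≤n

indicator-mono-< : {P Q : Set} (P? : Dec P) (Q? : Dec Q) → ¬ P → Q →
                   indicator P? < indicator Q?
indicator-mono-< (yes p) Q?      ¬p q = contradiction p ¬p
indicator-mono-< (no _)  (yes _) ¬p q = ≤-refl
indicator-mono-< (no _)  (no ¬q) ¬p q = contradiction q ¬q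

indicator-disjoint : {P Q R : Set} (P? : Dec P) (Q? : Dec Q) (R? : Dec R) →
  (P → R) → (Q → R) → ¬ (P × Q) → indicator P? + indicator Q? ≤ indicator R?
indicator-disjoint (yes p) (yes q) R? P⇒R Q⇒R ¬pq = contradiction (p , q) ¬pq
indicator-disjoint (yes p) (no ¬q) R? P⇒R Q⇒R ¬pq = indicator-mono (yes p) R? P⇒R
indicator-disjoint (no ¬p) Q?      R? P⇒R Q⇒R ¬pq = indicator-mono Q? R? Q⇒R

count : ∀ {n} {P : Fin n → Set} → (∀ i → Dec (P i)) → ℕ
count P? = sum (λ i → indicator (P? i))

module _ {n} {P Q : Fin n → Set} (P? : ∀ i → Dec (P i)) (Q? : ∀ i → Dec (Q i)) where

  count-mono : (∀ i → P i → Q i) → count P? ≤ count Q?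
  count-mono P⇒Q = sum-mono-≤ λ i → indicator-mono (P? i) (Q? i) (P⇒Q i)

  count-mono-< : (∀ i → P i → Q i) → ∀ i → ¬ P i → Q i → count P? < count Q?
  count-mono-< P⇒Q i ¬p q =
    sum-mono-< (λ j → indicator-mono (P? j) (Q? j) (P⇒Q j)) i
               (indicator-mono-< (P? i) (Q? i) ¬p q)

  count-disjoint : {R : Fin n → Set} (R? : ∀ i → Dec (R i)) →
    (∀ i → P i → R i) → (∀ i → Q i → R i) → (∀ i → ¬ (P i × Q i)) →
    count P? + count Q? ≤ count R?
  count-disjoint R? P⇒R Q⇒R disjoint = ≤-trans
    (≤-reflexive (sym (∑-distrib-+ (indicator ∘ P?) (indicator ∘ Q?))))
    (sum-mono-≤ λ i → indicator-disjoint (P? i) (Q? i) (R? i) (P⇒R i) (Q⇒R i) (disjoint i))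

count≤n : ∀ {n} {P : Fin n → Set} (P? : ∀ i → Dec (P i)) → count P? ≤ n
count≤n {n} P? = ≤-trans (sum-≤-const (λ i → indicator≤1 (P? i))) (≤-reflexive (*-identityʳ n))

count-positive : ∀ {n} {P : Fin n → Set} (P? : ∀ i → Dec (P i)) i → P i → 0 < count P?
count-positive {P = P} P? i p = ≤-trans (s≤s z≤n)
  (count-mono-< {P = λ _ → ⊥} (λ _ → no λ ()) P? (λ _ ()) i (λ ()) p)

-- Graphs, degrees and edge insertion

Adj? : ∀ {n} (G : Graph n) u v → Dec (Adj G u v)
Adj? G u v = T? (Graph.adjacent G u v)

Adj-sym : ∀ {n} (G : Graph n) {u v} → Adj G u v → Adj G v u
Adj-sym G {u} {v} = subst T (Graph.symmetric G u v)

Adj-irrefl : ∀ {n} (G : Graph n) {u} → ¬ Adj G u u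
Adj-irrefl G {u} = subst T (Graph.irreflexive G u)

emptyGraph : ∀ {n} → Graph n
emptyGraph = record
  { adjacent = λ _ _ → false ; symmetric = λ _ _ → refl ; irreflexive = λ _ → refl }

degree : ∀ {n} → Graph n → Fin n → ℕ
degree G u = count (Adj? G u)

degree-mono : ∀ {n} {G H : Graph n} → G ⊆ᴳ H → ∀ u → degree G u ≤ degree H u
degree-mono {G = G} {H} G⊆H u = count-mono (Adj? G u) (Adj? H u) (G⊆H u)

module _ {n : ℕ} where

  -- Requiring `x ≢ y` keeps `addEdge` loop-free even for `u = v`, so any list of pairs can be added
  -- to a graph without a side condition.
  SameEdge : (u v x y : Fin n) → Set
  SameEdge u v x y = x ≢ y × ((x ≡ u × y ≡ v) ⊎ (x ≡ v × y ≡ u))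

  sameEdge? : ∀ u v x y → Dec (SameEdge u v x y)
  sameEdge? u v x y =
    ¬? (x ≟ y) ×-dec (((x ≟ u) ×-dec (y ≟ v)) ⊎-dec ((x ≟ v) ×-dec (y ≟ u)))

  sameEdge-sym : ∀ {u v x y} → SameEdge u v x y → SameEdge u v y x
  sameEdge-sym (x≢y , inj₁ (p , q)) = x≢y ∘ sym , inj₂ (q , p)
  sameEdge-sym (x≢y , inj₂ (p , q)) = x≢y ∘ sym , inj₁ (q , p)

  addEdge : Graph n → Fin n → Fin n → Graph n
  addEdge H u v = record
    { adjacent    = λ x y → Graph.adjacent H x y ∨ ⌊ sameEdge? u v x y ⌋
    ; symmetric   = λ x y → cong₂ _∨_ (Graph.symmetric H x y) (new-sym x y)
    ; irreflexive = λ x → cong₂ _∨_ (Graph.irreflexive H x) (new-irrefl x)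
    }
    where
    new-sym : ∀ x y → ⌊ sameEdge? u v x y ⌋ ≡ ⌊ sameEdge? u v y x ⌋
    new-sym x y with sameEdge? u v x y | sameEdge? u v y x
    ... | yes _ | yes _ = refl
    ... | yes p | no ¬q = contradiction (sameEdge-sym p) ¬q
    ... | no ¬p | yes q = contradiction (sameEdge-sym q) ¬p
    ... | no _  | no _  = refl
    new-irrefl : ∀ x → ⌊ sameEdge? u v x x ⌋ ≡ false
    new-irrefl x with sameEdge? u v x x
    ... | yes (x≢x , _) = contradiction refl x≢x
    ... | no _          = refl

  addEdge-⊇ : ∀ H u v → H ⊆ᴳ addEdge H u v
  addEdge-⊇ H u v x y e = Equivalence.from T-∨ (inj₁ e)

  addEdge-new : ∀ H {u v} → u ≢ v → Adj (addEdge H u v) u v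
  addEdge-new H {u} {v} u≢v = Equivalence.from T-∨
    (inj₂ (fromWitness {a? = sameEdge? u v u v} (u≢v , inj₁ (refl , refl))))

  addEdge-⊆ : ∀ {G H : Graph n} {u v} → H ⊆ᴳ G → Adj G u v → addEdge H u v ⊆ᴳ G
  addEdge-⊆ {G} {H} {u} {v} H⊆G uv x y e
    with Equivalence.to (T-∨ {x = Graph.adjacent H x y}) e
  ... | inj₁ old = H⊆G x y old
  ... | inj₂ new with toWitness {a? = sameEdge? u v x y} new
  ... | _ , inj₁ (refl , refl) = uv
  ... | _ , inj₂ (refl , refl) = Adj-sym G uv

-- Short walks

module _ {n : ℕ} where

  -- Reach G ℓ u v: there is a walk of length strictly less than ℓ.  The strict
  -- bound makes Reach G 0 empty, so that predecessors of levels can be truncated.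
  data Reach (G : Graph n) : ℕ → Fin n → Fin n → Set where
    start  : ∀ {ℓ u} → Reach G (suc ℓ) u u
    extend : ∀ {ℓ u w v} → Reach G ℓ u w → Adj G w v → Reach G (suc ℓ) u v

  reach? : ∀ G ℓ u v → Dec (Reach G ℓ u v)
  reach? G zero    u v = no λ ()
  reach? G (suc ℓ) u v = map′
    (λ { (inj₁ refl) → start ; (inj₂ (w , r , e)) → extend r e })
    (λ { start → inj₁ refl ; (extend r e) → inj₂ (_ , r , e) })
    ((u ≟ v) ⊎-dec any? (λ w → reach? G ℓ u w ×-dec Adj? G w v))

  reach-mono : ∀ {G H ℓ m u v} → G ⊆ᴳ H → ℓ ≤ m → Reach G ℓ u v → Reach H m u v
  reach-mono G⊆H (s≤s ℓ≤m) start        = start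
  reach-mono G⊆H (s≤s ℓ≤m) (extend r e) = extend (reach-mono G⊆H ℓ≤m r) (G⊆H _ _ e)

  reach-weaken : ∀ {G ℓ m u v} → ℓ ≤ m → Reach G ℓ u v → Reach G m u v
  reach-weaken = reach-mono (λ _ _ e → e)

  reach-++ : ∀ {G ℓ m u v w} → Reach G (suc ℓ) u v → Reach G (suc m) v w →
             Reach G (suc (ℓ + m)) u w
  reach-++ {ℓ = ℓ} {m} r start = reach-weaken (s≤s (m≤m+n ℓ m)) r
  reach-++ {ℓ = ℓ} {suc m} r (extend q e) =
    extend (reach-weaken (≤-reflexive (sym (+-suc ℓ m))) (reach-++ r q)) e

  reach-edge : ∀ {G u v} → Adj G u v → Reach G 2 u v
  reach-edge e = extend start e

  reach-sym : ∀ {G ℓ u v} → Reach G ℓ u v → Reach G ℓ v u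
  reach-sym start = start
  reach-sym {G} {suc (suc ℓ)} (extend r e) =
    reach-++ (reach-edge (Adj-sym G e)) (reach-sym r)

  walk⇒reach : ∀ {G ℓ u v} → Walk G ℓ u v → Reach G (suc ℓ) u v
  walk⇒reach here       = start
  walk⇒reach (step e w) = reach-++ (reach-edge e) (walk⇒reach w)

  walk-snoc : ∀ {G : Graph n} {ℓ u v w} → Walk G ℓ u v → Adj G v w → Walk G (suc ℓ) u w
  walk-snoc here       e = step e here
  walk-snoc (step f w) e = step f (walk-snoc w e)

  reach⇒walk : ∀ {G ℓ u v} → Reach G ℓ u v → ∃ λ m → m < ℓ × Walk G m u v
  reach⇒walk start = 0 , s≤s z≤n , here
  reach⇒walk (extend r e) with reach⇒walk r
  ... | m , m<ℓ , walk = suc m , s≤s m<ℓ , walk-snoc walk e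

  reach⇒distance : ∀ {G} ℓ {u v} → Reach G ℓ u v → ∃ λ d → Distance G u v d × d < ℓ
  reach⇒distance {G} (suc ℓ) {u} {v} r with reach? G ℓ u v
  ... | yes r′ = map₂ (map₂ m<n⇒m<1+n) (reach⇒distance ℓ r′)
  ... | no ¬r with reach⇒walk r
  ... | m , s≤s m≤ℓ , walk = m , (walk , least) , s≤s m≤ℓ
    where
    least : ∀ k → Walk G k u v → m ≤ k
    least k w = ≮⇒≥ λ k<m →
      ¬r (reach-weaken (≤-trans k<m m≤ℓ) (walk⇒reach w))

  reachable : Graph n → ℕ → Fin n → ℕ
  reachable G ℓ u = count (reach? G ℓ u)

  reachable-mono : ∀ {G H} → G ⊆ᴳ H → ∀ {ℓ m} → ℓ ≤ m → ∀ u → reachable G ℓ u ≤ reachable H m u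
  reachable-mono G⊆H ℓ≤m u =
    count-mono (reach? _ _ u) (reach? _ _ u) (λ _ → reach-mono G⊆H ℓ≤m)

  -- Each level of the breadth-first search up to the one of v contributes a vertex.
  new-reach⇒reachable : ∀ {G} ℓ {u v} → Reach G (suc ℓ) u v → ¬ Reach G ℓ u v →
                        ℓ < reachable G (suc ℓ) u
  new-reach⇒reachable zero r ¬r = count-positive (reach? _ 1 _) _ r
  new-reach⇒reachable (suc ℓ) start ¬r = contradiction start ¬r
  new-reach⇒reachable {G} (suc ℓ) {u} {v} (extend r e) ¬r =
    <-≤-trans (s≤s (new-reach⇒reachable ℓ r λ r′ → ¬r (extend r′ e)))
      (count-mono-< (reach? G (suc ℓ) u) (reach? G (suc (suc ℓ)) u)
        (λ _ → reach-weaken (n≤1+n _)) v ¬r (extend r e))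

  -- Once the bound is the least one reaching `v`, every level up to it has contributed a vertex, so
  -- it is at most `n`.
  reach⇒reach-n : ∀ {G} ℓ {u v} → Reach G ℓ u v → Reach G n u v
  reach⇒reach-n {G} (suc ℓ) {u} {v} r with reach? G ℓ u v
  ... | yes r′ = reach⇒reach-n ℓ r′
  ... | no ¬r  = reach-weaken
    (≤-trans (new-reach⇒reachable ℓ r ¬r) (count≤n (reach? G (suc ℓ) u))) r

-- Greedy posting of edges

-- `base` is a graph that stays on the blackboard throughout the round. By antitonicity an edge once
-- refused stays refused, so one pass over the sites suffices; `potential` rises with every posted
-- edge and thereby bounds their number.
record Demand (n : ℕ) : Set₁ where
  field
    base      : Graph n
    Wanted    : Graph n → Fin n → Fin n → Set
    wanted?   : ∀ H u v → Dec (Wanted H u v)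
    antitone  : ∀ {H H′ u v} → H ⊆ᴳ H′ → Wanted H′ u v → Wanted H u v
    satisfied : ∀ {H u v} → base ⊆ᴳ H → Adj H u v → ¬ Wanted H u v
    potential : Graph n → ℕ
    increase  : ∀ {H u v} → base ⊆ᴳ H → u ≢ v → Wanted H u v →
                potential H < potential (addEdge H u v)

module _ {n : ℕ} where

  addAll : Graph n → List (Fin n × Fin n) → Graph n
  addAll H []             = H
  addAll H ((u , v) ∷ es) = addAll (addEdge H u v) es

  module _ (W : Demand n) (E : Graph n) where
    open Demand W

    posts : List (Fin n × Fin n) → Graph n → List (Fin n × Fin n)
    posts []             H = []
    posts ((u , v) ∷ es) H with Adj? E u v ×-dec wanted? H u v
    ... | yes _ = (u , v) ∷ posts es (addEdge H u v)
    ... | no  _ = posts es H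

    length-posts : ∀ es H → length (posts es H) ≤ length es
    length-posts []             H = z≤n
    length-posts ((u , v) ∷ es) H with Adj? E u v ×-dec wanted? H u v
    ... | yes _ = s≤s (length-posts es (addEdge H u v))
    ... | no  _ = m≤n⇒m≤1+n (length-posts es H)

    posts-⊇ : ∀ es H → H ⊆ᴳ addAll H (posts es H)
    posts-⊇ []             H x y e = e
    posts-⊇ ((u , v) ∷ es) H with Adj? E u v ×-dec wanted? H u v
    ... | yes _ = λ x y e → posts-⊇ es (addEdge H u v) x y (addEdge-⊇ H u v x y e)
    ... | no  _ = posts-⊇ es H

    posts-⊆ : ∀ {G} → E ⊆ᴳ G → ∀ es {H} → H ⊆ᴳ G → addAll H (posts es H) ⊆ᴳ G
    posts-⊆ E⊆G []             H⊆G = H⊆G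
    posts-⊆ {G} E⊆G ((u , v) ∷ es) {H} H⊆G with Adj? E u v ×-dec wanted? H u v
    ... | yes (e , _) = posts-⊆ {G} E⊆G es (addEdge-⊆ {G = G} {H} H⊆G (E⊆G u v e))
    ... | no  _       = posts-⊆ {G} E⊆G es H⊆G

    base-⊆-addEdge : ∀ H {u v} → base ⊆ᴳ H → base ⊆ᴳ addEdge H u v
    base-⊆-addEdge H b x y e = addEdge-⊇ H _ _ x y (b x y e)

    posts-unwanted : ∀ es H → base ⊆ᴳ H → ∀ {u v} → (u , v) ∈ es → Adj E u v →
                     ¬ Wanted (addAll H (posts es H)) u v
    posts-unwanted ((u , v) ∷ es) H b (here refl) e with Adj? E u v ×-dec wanted? H u v
    ... | yes _ = satisfied
      (λ x y → posts-⊇ es (addEdge H u v) x y ∘ base-⊆-addEdge H b x y)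
      (posts-⊇ es (addEdge H u v) u v (addEdge-new H λ { refl → Adj-irrefl E e }))
    ... | no ¬w = λ w → ¬w (e , antitone (posts-⊇ es H) w)
    posts-unwanted ((u , v) ∷ es) H b (there e∈es) with Adj? E u v ×-dec wanted? H u v
    ... | yes _ = posts-unwanted es (addEdge H u v) (base-⊆-addEdge H b) e∈es
    ... | no  _ = posts-unwanted es H b e∈es

    posts-potential : ∀ es H → base ⊆ᴳ H →
                      length (posts es H) + potential H ≤ potential (addAll H (posts es H))
    posts-potential []             H b = ≤-refl
    posts-potential ((u , v) ∷ es) H b with Adj? E u v ×-dec wanted? H u v
    ... | yes (e , w) = ≤-trans
      (≤-trans (≤-reflexive (sym (+-suc _ _)))
        (+-monoʳ-≤ (length (posts es (addEdge H u v))) (increase b (λ { refl → Adj-irrefl E e }) w)))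
      (posts-potential es (addEdge H u v) (base-⊆-addEdge H b))
    ... | no  _ = posts-potential es H b

  -- Ordered pairs: each edge is examined in both orientations, since a demand at `u` need not be
  -- one at `v`.
  allEdges : List (Fin n × Fin n)
  allEdges = cartesianProduct (allFin n) (allFin n)

-- Protocol building blocks

bit : Fin 2 → Bool
bit zero       = false
bit (suc zero) = true

unbit : Bool → Fin 2
unbit false = zero
unbit true  = suc zero

unbit-bit : ∀ i → unbit (bit i) ≡ i
unbit-bit zero       = refl
unbit-bit (suc zero) = refl

record Code (A : Set) (K : ℕ) : Set where
  field
    encode        : A → Fin (2 ^ K)
    decode        : Fin (2 ^ K) → A
    decode-encode : ∀ a → decode (encode a) ≡ a

finCode : ∀ {n K} → suc n ≤ 2 ^ K → Code (Fin (suc n)) K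
finCode {n} {K} n≤2^K = record
  { encode = λ i → inject≤ i n≤2^K ; decode = dec ; decode-encode = dec-enc }
  where
  dec : Fin (2 ^ K) → Fin (suc n)
  dec j with toℕ j <? suc n
  ... | yes j<n = fromℕ< j<n
  ... | no  _   = zero
  dec-enc : ∀ i → dec (inject≤ i n≤2^K) ≡ i
  dec-enc i with toℕ (inject≤ i n≤2^K) <? suc n
  ... | yes lt = toℕ-injective (trans (toℕ-fromℕ< lt) (toℕ-inject≤ i n≤2^K))
  ... | no ¬lt = contradiction (≤-trans (s≤s (≤-reflexive (toℕ-inject≤ i n≤2^K))) (toℕ<n i)) ¬lt

module _ {s : ℕ} {Local Coord Out : Set} where

  private P = Protocol s Local Coord Out

  sendFin : Fin s → (K : ℕ) → (Local → Fin (2 ^ K)) → (Fin (2 ^ K) → P) → P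
  sendFin i zero    m next = next zero
  sendFin i (suc K) m next = write i (bit ∘ proj₁ ∘ remQuot (2 ^ K) ∘ m) λ b →
    sendFin i K (proj₂ ∘ remQuot {2} (2 ^ K) ∘ m) (next ∘ combine (unbit b))

  module _ {A : Set} {K : ℕ} (code : Code A K) where
    open Code code

    headCode : List A → Fin (2 ^ K)
    -- A filler word: local functions are total, but `sendList` uses a head only after announcing
    -- one.
    headCode []      = subst Fin (suc-pred (2 ^ K) {{m^n≢0 2 K}}) zero
    headCode (a ∷ _) = encode a

    -- Each element is preceded by a bit saying that there is one.
    sendList : Fin s → ℕ → (Local → List A) → (List A → P) → P
    -- The bound `N` keeps the protocol tree finite; a list of length at most `N` is complete here,
    -- and its closing bit is saved.
    sendList i zero    m next = next []
    sendList i (suc N) m next = write i (not ∘ null ∘ m) λ where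
      false → next []
      true  → sendFin i K (headCode ∘ m) λ c →
              sendList i N (drop 1 ∘ m) (next ∘ (decode c ∷_))

  module _ (x : Fin s → Local) (c : Coord) where

    -- A reduction on a fixed input: `p` and `q` are whole protocols, so bounds for pieces in
    -- continuation-passing style chain by `↝-trans`.
    record _↝[_]_ (p : P) (b : ℕ) (q : P) : Set where
      constructor _,_
      field
        result-≡ : result p x c ≡ result q x c
        bits-≤   : bits p x ≤ b + bits q x

    ↝-refl : ∀ {p} → p ↝[ 0 ] p
    ↝-refl = refl , ≤-refl

    ↝-trans : ∀ {p q r a b} → p ↝[ a ] q → q ↝[ b ] r → p ↝[ a + b ] r
    ↝-trans {r = r} {a} {b} (e₁ , l₁) (e₂ , l₂) = trans e₁ e₂ ,
      ≤-trans l₁ (≤-trans (+-monoʳ-≤ a l₂) (≤-reflexive (sym (+-assoc a b (bits r x)))))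

    ↝-weaken : ∀ {p q a b} → a ≤ b → p ↝[ a ] q → p ↝[ b ] q
    ↝-weaken {q = q} a≤b (e , l) = e , ≤-trans l (+-monoˡ-≤ (bits q x) a≤b)

    write-↝ : ∀ {i b next β} → b (x i) ≡ β → write i b next ↝[ 1 ] next β
    write-↝ refl = refl , ≤-refl

    sendFin-↝ : ∀ i K m next → sendFin i K m next ↝[ K ] next (m (x i))
    sendFin-↝ i zero m next with m (x i)
    ... | zero = ↝-refl
    sendFin-↝ i (suc K) m next = ↝-trans (write-↝ refl)
      (subst (λ j → sent ↝[ K ] next j)
        (trans (cong (λ j → combine j lower) (unbit-bit upper)) (combine-remQuot {2} (2 ^ K) (m (x i))))
        (sendFin-↝ i K (proj₂ ∘ remQuot {2} (2 ^ K) ∘ m) (next ∘ combine (unbit (bit upper)))))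
      where
      upper : Fin 2
      upper = proj₁ (remQuot (2 ^ K) (m (x i)))
      lower : Fin (2 ^ K)
      lower = proj₂ (remQuot {2} (2 ^ K) (m (x i)))
      sent : P
      sent = sendFin i K (proj₂ ∘ remQuot {2} (2 ^ K) ∘ m) (next ∘ combine (unbit (bit upper)))

    module _ {A : Set} {K : ℕ} (code : Code A K) where
      open Code code

      sendList-↝ : ∀ i N m next → length (m (x i)) ≤ N →
        sendList code i N m next ↝[ 1 + length (m (x i)) * (1 + K) ] next (m (x i))
      sendList-↝ i zero m next len with m (x i)
      ... | [] = ↝-weaken z≤n ↝-refl
      sendList-↝ i (suc N) m next len
        -- The types of the two auxiliary facts mention `m (x i)`, so they are abstracted together
        -- with it.
        with m (x i) in eq
           | sendFin-↝ i K (headCode code ∘ m) (λ c → sendList code i N (drop 1 ∘ m) (next ∘ (decode c ∷_)))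
           | sendList-↝ i N (drop 1 ∘ m)
      ... | []     | _    | _    = write-↝ (cong (not ∘ null) eq)
      ... | a ∷ as | head | tail =
        ↝-weaken (≤-reflexive (cong suc (solve-∀′ K (length as))))
          (↝-trans (write-↝ (cong (not ∘ null) eq))
            (subst (λ a′ → _ ↝[ K + (1 + length as * (1 + K)) ] next (a′ ∷ as)) (decode-encode a)
              (↝-trans head (tail (next ∘ (decode (encode a) ∷_)) (s≤s⁻¹ len)))))
        where
        solve-∀′ : ∀ K l → K + (1 + l * (1 + K)) ≡ (1 + K) + l * (1 + K)
        solve-∀′ = solve-∀

pairCode : ∀ {A B K L} → Code A K → Code B L → Code (A × B) (K + L)
pairCode {A} {B} {K} {L} codeA codeB = record
  { encode        = λ (a , b) → subst Fin (sym split) (combine (A.encode a) (B.encode b))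
  ; decode        = λ j → map A.decode B.decode (remQuot (2 ^ L) (subst Fin split j))
  ; decode-encode = λ (a , b) → trans
      (cong (map A.decode B.decode ∘ remQuot (2 ^ L)) (subst-subst-sym split))
      (trans (cong (map A.decode B.decode) (remQuot-combine (A.encode a) (B.encode b)))
             (cong₂ _,_ (A.decode-encode a) (B.decode-encode b)))
  }
  where
  module A = Code codeA
  module B = Code codeB
  split : 2 ^ (K + L) ≡ 2 ^ K * 2 ^ L
  split = ^-distribˡ-+-* 2 K L

-- Rounds in which all sites post

module _ {n s K : ℕ} (code : Code (Fin n × Fin n) K) {X Coord Out : Set} where

  private P = Protocol s (Graph n × X) Coord Out

  -- The graph `H` is fixed by the position in the protocol tree, hence common knowledge; only `E`
  -- is private. Edges already in `H` are unwanted once `H` contains the base, so an edge held by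
  -- several sites is not posted again.
  visit : Demand n → List (Fin s) → Graph n → (Graph n → P) → P
  visit W []       H next = next H
  visit W (i ∷ is) H next =
    sendList code i (length (allEdges {n})) (λ (E , _) → posts W E allEdges H) λ es →
    visit W is (addAll H es) next

  round : Demand n → Graph n → (Graph n → P) → P
  round W = visit W (allFin s)

  module _ (D : DistributedGraph n s) (seeds : Fin s → X) (c : Coord) where

    private
      G : Graph n
      G = graph D
      x : Fin s → Graph n × X
      x i = site D i , seeds i

    site-⊆ : ∀ i → site D i ⊆ᴳ G
    site-⊆ i u v e = Equivalence.from (union D u v) (i , e)

    record Visited (W : Demand n) (is : List (Fin s)) (H : Graph n) : Set where
      open Demand W
      field
        H′       : Graph n
        posted   : ℕ
        run      : ∀ next → _↝[_]_ x c (visit W is H next) (length is + posted * (1 + K)) (next H′)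
        H⊆H′     : H ⊆ᴳ H′
        H′⊆G     : H′ ⊆ᴳ G
        unwanted : ∀ {i} → i ∈ is → ∀ u v → Adj (site D i) u v → ¬ Wanted H′ u v
        grown    : posted + potential H ≤ potential H′

    visited : ∀ W is {H} → Demand.base W ⊆ᴳ H → H ⊆ᴳ G → Visited W is H
    visited W [] {H} b H⊆G = record
      { H′ = H ; posted = 0 ; run = λ next → ↝-refl x c ; H⊆H′ = λ _ _ e → e ; H′⊆G = H⊆G
      ; unwanted = λ () ; grown = ≤-refl }
    visited W (i ∷ is) {H} b H⊆G = record
      { H′       = V.H′
      ; posted   = length new + V.posted
      ; run      = λ next → ↝-weaken x c (≤-reflexive (arith (length new) (length is) V.posted K))
                     (↝-trans x c
                       (sendList-↝ x c code i _ _ _ (length-posts W (site D i) allEdges H))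
                       (V.run next))
      ; H⊆H′     = λ u v → V.H⊆H′ u v ∘ posts-⊇ W (site D i) allEdges H u v
      ; H′⊆G     = V.H′⊆G
      ; unwanted = λ where
          (here refl)  u v e → posts-unwanted W (site D i) allEdges H b
                                 (∈-cartesianProduct⁺ (∈-allFin u) (∈-allFin v)) e
                               ∘ antitone V.H⊆H′
          (there i∈is) → V.unwanted i∈is
      ; grown    = begin
          length new + V.posted + potential H   ≡⟨ +-assoc (length new) _ _ ⟩
          length new + (V.posted + potential H) ≡⟨ swap-first (length new) V.posted (potential H) ⟩
          V.posted + (length new + potential H)
            ≤⟨ +-monoʳ-≤ V.posted (posts-potential W (site D i) allEdges H b) ⟩
          V.posted + potential (addAll H new)   ≤⟨ V.grown ⟩
          potential V.H′                        ∎
      }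
      where
      open Demand W
      open ≤-Reasoning
      new : List (Fin n × Fin n)
      new = posts W (site D i) allEdges H
      module V = Visited (visited W is {addAll H new}
        (λ u v → posts-⊇ W (site D i) allEdges H u v ∘ b u v)
        (posts-⊆ W (site D i) {G} (site-⊆ i) allEdges H⊆G))
      arith : ∀ a b c k → 1 + a * (1 + k) + (b + c * (1 + k)) ≡ 1 + b + (a + c) * (1 + k)
      arith = solve-∀
      swap-first : ∀ a b c → a + (b + c) ≡ b + (a + c)
      swap-first = solve-∀

    record RoundResult (W : Demand n) (H : Graph n) : Set where
      open Demand W
      field
        H′       : Graph n
        posted   : ℕ
        run      : ∀ next → _↝[_]_ x c (round W H next) (s + posted * (1 + K)) (next H′)
        H⊆H′     : H ⊆ᴳ H′
        H′⊆G     : H′ ⊆ᴳ G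
        unwanted : ∀ u v → Adj G u v → ¬ Wanted H′ u v
        grown    : posted + potential H ≤ potential H′

    roundResult : ∀ W {H} → Demand.base W ⊆ᴳ H → H ⊆ᴳ G → RoundResult W H
    roundResult W {H} b H⊆G = record
      { H′       = H′
      ; posted   = posted
      ; run      = λ next → ↝-weaken x c
                     (≤-reflexive (cong (_+ posted * (1 + K)) (length-tabulate id))) (run next)
      ; H⊆H′     = H⊆H′
      ; H′⊆G     = H′⊆G
      ; unwanted = λ u v e → let i , e′ = Equivalence.to (union D u v) e in
                     unwanted (∈-allFin i) u v e′
      ; grown    = grown
      }
      where open Visited (visited W (allFin s) b H⊆G)

-- Demands for saturating degrees and for expanding searches

saturate : ∀ {n} → ℕ → Demand n
saturate d = record
  { base      = emptyGraph
  ; Wanted    = λ H u v → ¬ Adj H u v × degree H u < d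
  ; wanted?   = λ H u v → ¬? (Adj? H u v) ×-dec (degree H u <? d)
  ; antitone  = λ {H} {H′} {u} H⊆H′ (¬e , lt) →
      ¬e ∘ H⊆H′ _ _ , ≤-<-trans (degree-mono {G = H} {H′} H⊆H′ u) lt
  ; satisfied = λ _ e (¬e , _) → ¬e e
  -- Degrees truncated at `d` sum to at most `n * d`, which bounds the saturating posts.
  ; potential = λ H → sum (λ u → degree H u ⊓ d)
  ; increase  = λ {H} {u} {v} _ u≢v (¬e , lt) →
      let H⊆H′ = addEdge-⊇ H u v
          more : degree H u < degree (addEdge H u v) u
          more = count-mono-< (Adj? H u) (Adj? (addEdge H u v) u) (H⊆H′ u) v ¬e (addEdge-new H u≢v)
      in sum-mono-<
           (λ w → ⊓-monoˡ-≤ d (degree-mono {G = H} {addEdge H u v} H⊆H′ w)) u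
           (≤-<-trans (m⊓n≤m (degree H u) d) (⊓-glb more lt))
  }

-- The processed level is read off the blackboard H₀ at the start of the round: read
-- off H it would grow during the round and the demand would not be antitone.
expand : ∀ {n m} → (Fin m → Fin n) → (Fin m → ℕ) → Graph n → Demand n
expand R a H₀ = record
  { base      = H₀
  ; Wanted    = λ H u v → ∃ λ j → Reach H₀ (a j) (R j) u × ¬ Reach H (suc (a j)) (R j) v
  ; wanted?   = λ H u v → any? λ j → reach? H₀ (a j) (R j) u ×-dec ¬? (reach? H (suc (a j)) (R j) v)
  ; antitone  = λ H⊆H′ (j , r , ¬r) → j , r , ¬r ∘ reach-mono H⊆H′ ≤-refl
  ; satisfied = λ b e (j , r , ¬r) → ¬r (extend (reach-mono b ≤-refl r) e)
  ; potential = λ H → sum (λ j → reachable H (suc (a j)) (R j))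
  ; increase  = λ {H} {u} {v} b u≢v (j , r , ¬r) →
      let H⊆H′ = addEdge-⊇ H u v
      in sum-mono-< (λ i → reachable-mono H⊆H′ ≤-refl (R i)) j
           (count-mono-< (reach? H _ (R j)) (reach? (addEdge H u v) _ (R j))
             (λ _ → reach-mono H⊆H′ ≤-refl) v ¬r
             (extend (reach-mono (λ x y → H⊆H′ x y ∘ b x y) ≤-refl r) (addEdge-new H u≢v)))
  }

-- Hitting sets

module HittingSet {n : ℕ} (H : Graph (suc n)) (d q : ℕ) (n≤q*d : suc n ≤ q * d) where

  Unhit : List (Fin (suc n)) → Fin (suc n) → Set
  Unhit R u = d ≤ degree H u × ¬ Any (Adj H u) R

  unhit? : ∀ R u → Dec (Unhit R u)
  unhit? R u = (d ≤? degree H u) ×-dec ¬? (Any.any? (Adj? H u) R)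

  unhit : List (Fin (suc n)) → ℕ
  unhit R = count (unhit? R)

  hitBy? : ∀ R r u → Dec (Unhit R u × Adj H u r)
  hitBy? R r u = unhit? R u ×-dec Adj? H u r

  -- Averaging: the degrees of the unhit vertices count the pairs (u , r).
  popular : ∀ R → ∃ λ r → unhit R * d ≤ suc n * count (hitBy? R r)
  popular R with maximum (λ r → count (hitBy? R r))
  ... | r , max = r , (begin
    unhit R * d                                          ≡⟨ *-distribʳ-sum d (indicator ∘ unhit? R) ⟩
    sum (λ u → indicator (unhit? R u) * d)               ≤⟨ sum-mono-≤ row ⟩
    sum (λ u → sum (λ r → indicator (hitBy? R r u)))     ≡⟨ ∑-comm (λ u r → indicator (hitBy? R r u)) ⟩
    sum (λ r → count (hitBy? R r))                       ≤⟨ sum-≤-const max ⟩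
    suc n * count (hitBy? R r)                           ∎)
    where
    open ≤-Reasoning
    row : ∀ u → indicator (unhit? R u) * d ≤ count (λ r → hitBy? R r u)
    row u with unhit? R u in eq
    ... | no  _ = z≤n
    ... | yes p = ≤-trans (≤-reflexive (*-identityˡ d)) (≤-trans (proj₁ p)
      (count-mono (Adj? H u) (λ r → yes p ×-dec Adj? H u r) (λ r e → p , e)))

  unhit-∷ : ∀ r R → unhit (r ∷ R) + count (hitBy? R r) ≤ unhit R
  unhit-∷ r R = count-disjoint (unhit? (r ∷ R)) (hitBy? R r) (unhit? R)
    (λ u (deg , ¬hit) → deg , ¬hit ∘ there) (λ u → proj₁)
    (λ u ((_ , ¬hit) , (_ , e)) → ¬hit (here e))

  -- While m vertices are unhit, each new vertex hits at least m d / n of them.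
  greedy : ∀ m R t → unhit R < 2 * m →
    Σ (List (Fin (suc n))) λ R′ → length R′ ≤ t + length R ×
      (unhit R′ < m ⊎ suc n * unhit R′ + t * (m * d) < suc n * (2 * m))
  greedy m R zero    lt = R , ≤-refl , inj₂
    (≤-trans (s≤s (≤-reflexive (+-identityʳ _))) (*-monoʳ-< (suc n) lt))
  greedy m R (suc t) lt with greedy m R t lt
  ... | R′ , len , inj₁ few = R′ , m≤n⇒m≤1+n len , inj₁ few
  ... | R′ , len , inj₂ bound with unhit R′ <? m
  ... | yes few = R′ , m≤n⇒m≤1+n len , inj₁ few
  ... | no ¬few with popular R′
  ... | r , pop = r ∷ R′ , s≤s len , inj₂ (≤-<-trans shrink bound)
    where
    open ≤-Reasoning
    -- Scaling by `suc n` avoids division: each chosen vertex lowers the first summand by at least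
    -- the `m * d` that the second one gains.
    shrink : suc n * unhit (r ∷ R′) + suc t * (m * d) ≤ suc n * unhit R′ + t * (m * d)
    shrink = begin
      suc n * unhit (r ∷ R′) + (m * d + t * (m * d))
        ≤⟨ +-monoʳ-≤ (suc n * unhit (r ∷ R′)) (+-monoˡ-≤ (t * (m * d))
             (≤-trans (*-monoˡ-≤ d (≮⇒≥ ¬few)) pop)) ⟩
      suc n * unhit (r ∷ R′) + (suc n * count (hitBy? R′ r) + t * (m * d))
        ≡⟨ assoc (suc n) (unhit (r ∷ R′)) (count (hitBy? R′ r)) (t * (m * d)) ⟩
      suc n * (unhit (r ∷ R′) + count (hitBy? R′ r)) + t * (m * d)
        ≤⟨ +-monoˡ-≤ (t * (m * d)) (*-monoʳ-≤ (suc n) (unhit-∷ r R′)) ⟩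
      suc n * unhit R′ + t * (m * d) ∎
      where
      assoc : ∀ a b c e → a * b + (a * c + e) ≡ a * (b + c) + e
      assoc = solve-∀

  -- After `q` choices the scaled count has dropped by `q * (m * d)`, which is at least `suc n * m`,
  -- half of the initial bound `suc n * (2 * m)`.
  halve : ∀ m R → unhit R < 2 * m →
    Σ (List (Fin (suc n))) λ R′ → length R′ ≤ q + length R × unhit R′ < m
  halve m R lt with greedy m R q lt
  ... | R′ , len , inj₁ few   = R′ , len , few
  ... | R′ , len , inj₂ bound = R′ , len ,
    *-cancelˡ-< (suc n) _ _ (+-cancelʳ-< (suc n * m) _ _ (begin-strict
      suc n * unhit R′ + suc n * m     ≤⟨ +-monoʳ-≤ (suc n * unhit R′) (*-monoˡ-≤ m n≤q*d) ⟩
      suc n * unhit R′ + q * d * m     ≡⟨ cong (suc n * unhit R′ +_) (swap q d m) ⟩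
      suc n * unhit R′ + q * (m * d)   <⟨ bound ⟩
      suc n * (2 * m)                  ≡⟨ double (suc n) m ⟩
      suc n * m + suc n * m            ∎))
    where
    open ≤-Reasoning
    swap : ∀ q d m → q * d * m ≡ q * (m * d)
    swap = solve-∀
    double : ∀ a m → a * (2 * m) ≡ a * m + a * m
    double = solve-∀

  -- Each of the `p` halvings costs at most `q` new elements; a count below `2 ^ p` ends at zero.
  halvings : ∀ p R → unhit R < 2 ^ p →
    Σ (List (Fin (suc n))) λ R′ → length R′ ≤ p * q + length R × unhit R′ < 1
  halvings zero    R lt = R , ≤-refl , lt
  halvings (suc p) R lt with halve (2 ^ p) R lt
  ... | R₁ , len₁ , lt₁ with halvings p R₁ lt₁
  ... | R₂ , len₂ , lt₂ = R₂ , ≤-trans len₂ (≤-trans (+-monoʳ-≤ (p * q) len₁)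
      (≤-reflexive (arith p q (length R)))) , lt₂
    where
    arith : ∀ p q l → p * q + (q + l) ≡ q + p * q + l
    arith = solve-∀

  hittingSet : ∀ p → suc n < 2 ^ p →
    Σ (List (Fin (suc n))) λ R → length R ≤ p * q × (∀ u → d ≤ degree H u → Any (Adj H u) R)
  hittingSet p n<2^p with halvings p [] (≤-<-trans (count≤n (unhit? [])) n<2^p)
  ... | R , len , none = R , ≤-trans len (≤-reflexive (+-identityʳ (p * q))) , λ u deg →
    decidable-stable (Any.any? (Adj? H u) R) λ ¬hit →
      <-irrefl refl (≤-trans none (count-positive (unhit? R) u (deg , ¬hit)))

-- Breadth-first levels

module Skip {n : ℕ} (H : Graph n) (d : ℕ) (r : Fin n) where

  -- As `Reach` is strict, a positive level `ℓ` consists of the vertices at distance exactly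
  -- `ℓ - 1`; level 0 is empty.
  Dense : ℕ → Set
  Dense ℓ = ∃ λ u → Reach H ℓ r u × ¬ Reach H (ℓ ∸ 1) r u × d ≤ degree H u

  dense? : ∀ ℓ → Dec (Dense ℓ)
  dense? ℓ = any? λ u → reach? H ℓ r u ×-dec ¬? (reach? H (ℓ ∸ 1) r u) ×-dec (d ≤? degree H u)

  -- `fuel` bounds the search for a dense level, which need not exist. With fuel `n` the second case
  -- of `stop` puts the level beyond all finite distances.
  record Skipped (c : ℕ) (fuel : ℕ) : Set where
    field
      level  : ℕ
      c≤     : c ≤ level
      sparse : ∀ ℓ → c ≤ ℓ → ℓ < level → ¬ Dense ℓ
      stop   : Dense level ⊎ fuel + c ≤ level

  stay : ∀ {fuel} c → Dense c ⊎ fuel + c ≤ c → Skipped c fuel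
  stay c stop = record
    { level = c ; c≤ = ≤-refl ; stop = stop
    ; sparse = λ ℓ c≤ℓ ℓ<c → contradiction c≤ℓ (<⇒≱ ℓ<c) }

  skip : ∀ fuel c → Skipped c fuel
  skip zero       c = stay c (inj₂ ≤-refl)
  skip (suc fuel) c with dense? c
  ... | yes dense = stay c (inj₁ dense)
  ... | no ¬dense = record
    { level  = level
    ; c≤     = ≤-trans (n≤1+n c) c≤
    ; sparse = λ ℓ c≤ℓ ℓ<level →
        [ (λ c<ℓ → sparse ℓ c<ℓ ℓ<level) , (λ { refl → ¬dense }) ]′ (m≤n⇒m<n∨m≡n c≤ℓ)
    ; stop   = [ inj₁ , inj₂ ∘ ≤-trans (≤-reflexive (sym (+-suc fuel c))) ]′ stop
    }
    where open Skipped (skip fuel (suc c))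

  -- A neighbour of a vertex on level `ℓ` within reach `ℓ - 2` would pull that vertex to an earlier
  -- level. So its neighbours, at least `d` of them, are all new compared with `ℓ - 2`; this is why
  -- blocks span three levels.
  dense-reachable : ∀ ℓ → Dense ℓ → reachable H (ℓ ∸ 2) r + d ≤ reachable H (suc ℓ) r
  dense-reachable (suc ℓ) (u , ru , ¬ru , deg) = ≤-trans
    (+-monoʳ-≤ (reachable H (ℓ ∸ 1) r) deg)
    (count-disjoint (reach? H (ℓ ∸ 1) r) (Adj? H u) (reach? H (suc (suc ℓ)) r)
      (λ _ → reach-weaken (≤-trans (m∸n≤m ℓ 1) (≤-trans (n≤1+n ℓ) (n≤1+n (suc ℓ)))))
      (λ _ → extend ru)
      (λ v (rv , e) → ¬ru (back ℓ rv e)))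
    where
    back : ∀ ℓ {v} → Reach H (ℓ ∸ 1) r v → Adj H u v → Reach H ℓ r u
    back (suc ℓ) rv e = extend rv (Adj-sym H e)

module _ {n : ℕ} (G : Graph n) where

  -- The converse inclusion is automatic for subgraphs of `G`. All bounds up to `c` are included, so
  -- that distances agree and not only the reached sets.
  Exact : Graph n → Fin n → ℕ → Set
  Exact H r c = ∀ {ℓ} → ℓ ≤ c → ∀ {v} → Reach G ℓ r v → Reach H ℓ r v

  Known : Graph n → Fin n → Set
  Known H u = ∀ v → Adj G u v → Adj H u v

  -- Splitting off the last edge of a walk leaves one within the exact range, so only edges out of
  -- the set already reached in `H` need checking.
  exact-suc : ∀ {H H′ r c} → H ⊆ᴳ H′ → Exact H r c →
    (∀ {u} v → Reach H c r u → Adj G u v → Reach H′ (suc c) r v) → Exact H′ r (suc c)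
  exact-suc {c = c} H⊆H′ exact next {ℓ} ℓ≤ rv with m≤n⇒m<n∨m≡n ℓ≤
  ... | inj₁ ℓ<            = reach-mono H⊆H′ ≤-refl (exact (s≤s⁻¹ ℓ<) rv)
  exact-suc H⊆H′ exact next _ start        | inj₂ refl = start
  exact-suc H⊆H′ exact next _ (extend ru e) | inj₂ refl = next _ (exact ≤-refl ru) e

  -- A vertex of degree below d has no unknown edges, and a vertex on an earlier
  -- level has its neighbours on levels that are already exact.
  exact-sparse : ∀ {H d r c} → H ⊆ᴳ G → (∀ u → Known H u ⊎ d ≤ degree H u) →
    ¬ Skip.Dense H d r c → Exact H r c → Exact H r (suc c)
  exact-sparse {H} {d} {r} {c} H⊆G known ¬dense exact = exact-suc (λ _ _ e → e) exact next
    where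
    earlier : ∀ {c u} v → Exact H r c → Reach H (c ∸ 1) r u → Reach H c r u → Adj G u v →
              Reach H c r v
    earlier {suc c} v exact ru _ e = exact ≤-refl (extend (reach-mono H⊆G ≤-refl ru) e)
    next : ∀ {u} v → Reach H c r u → Adj G u v → Reach H (suc c) r v
    next {u} v ru e with known u
    ... | inj₁ all  = extend ru (all v e)
    ... | inj₂ deg with reach? H (c ∸ 1) r u
    ... | yes ru′ = reach-weaken (n≤1+n c) (earlier v exact ru′ ru e)
    ... | no ¬ru′ = contradiction (u , ru , ¬ru′ , deg) ¬dense

  exact-skip : ∀ {H d r c m} → H ⊆ᴳ G → (∀ u → Known H u ⊎ d ≤ degree H u) → c ≤ m →
    (∀ ℓ → c ≤ ℓ → ℓ < m → ¬ Skip.Dense H d r ℓ) → Exact H r c → Exact H r m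
  exact-skip {m = zero}  H⊆G known z≤n sparse exact = exact
  exact-skip {m = suc m} H⊆G known c≤ sparse exact with m≤n⇒m<n∨m≡n c≤
  ... | inj₂ refl = exact
  ... | inj₁ c<   = exact-sparse H⊆G known (sparse m (s≤s⁻¹ c<) ≤-refl)
    (exact-skip H⊆G known (s≤s⁻¹ c<) (λ ℓ c≤ℓ ℓ<m → sparse ℓ c≤ℓ (m<n⇒m<1+n ℓ<m)) exact)

  -- Reachable vertices are reached within `n`, so exactness up to `n` already covers every bound.
  exact-∞ : ∀ {H r c} → n ≤ c → Exact H r c → ∀ c′ → Exact H r c′
  exact-∞ {c = c} n≤c exact _ {ℓ} _ rv with ≤-total ℓ c
  ... | inj₁ ℓ≤c = exact ℓ≤c rv
  ... | inj₂ c≤ℓ = reach-weaken (≤-trans n≤c c≤ℓ) (exact n≤c (reach⇒reach-n ℓ rv))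

  -- If a walk leaves the spanner at x, it can be rerouted through a breadth-first
  -- search root adjacent to x in the spanner, at the price of two more edges.
  spanner : ∀ {m H} (R : Fin m → Fin n) → H ⊆ᴳ G →
    (∀ u → Known H u ⊎ ∃ λ j → Adj H u (R j)) → (∀ j c → Exact H (R j) c) →
    ∀ {k} → 2 ≤ k → IsAdditiveSpanner k G H
  spanner {m} {H} R H⊆G covered exact {k} 2≤k = H⊆G , stretch
    where
    -- `x` is the first vertex for which `covered` names a root; if none is met, every edge of the
    -- walk lies in `H`.
    detour : ∀ {ℓ u v} → Walk G ℓ u v → (Walk H ℓ u v) ⊎
      (∃₂ λ ℓ₁ ℓ₂ → ∃₂ λ x j → Walk G ℓ₁ u x × Walk G ℓ₂ x v × ℓ₁ + ℓ₂ ≡ ℓ × Adj H x (R j))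
    detour here = inj₁ here
    detour {ℓ} (step {u = u} e w) with covered u
    ... | inj₂ (j , f) = inj₂ (0 , ℓ , u , j , here , step e w , refl , f)
    ... | inj₁ all with detour w
    ... | inj₁ w′ = inj₁ (step (all _ e) w′)
    ... | inj₂ (ℓ₁ , ℓ₂ , x , j , w₁ , w₂ , eq , f) =
      inj₂ (suc ℓ₁ , ℓ₂ , x , j , step e w₁ , w₂ , cong suc eq , f)

    reroute : ∀ {ℓ u v} → Walk G ℓ u v → Reach H (suc (ℓ + 2)) u v
    reroute {ℓ} w with detour w
    ... | inj₁ w′ = reach-weaken (s≤s (m≤m+n ℓ 2)) (walk⇒reach w′)
    ... | inj₂ (ℓ₁ , ℓ₂ , x , j , w₁ , w₂ , refl , f) =
      -- The root is one edge from `x`, so its distances in `H` to the two ends are at most `ℓ₁ + 1`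
      -- and `ℓ₂ + 1`.
      reach-weaken (≤-reflexive (arith ℓ₁ ℓ₂))
        (reach-++ {ℓ = suc ℓ₁} {m = suc ℓ₂}
          (reach-sym (exact j _ ≤-refl (reach-++ root (reach-sym (walk⇒reach w₁)))))
          (exact j _ ≤-refl (reach-++ root (walk⇒reach w₂))))
      where
      root : Reach G 2 (R j) x
      root = reach-edge (Adj-sym G (H⊆G x (R j) f))
      arith : ∀ a b → 1 + ((1 + a) + (1 + b)) ≡ 1 + (a + b + 2)
      arith = solve-∀

    stretch : ∀ u v d → Distance G u v d → ∃ λ d′ → Distance H u v d′ × d′ ≤ d + k
    stretch u v d (w , _) with reach⇒distance (suc (d + 2)) (reroute w)
    ... | d′ , dist , s≤s d′≤ = d′ , dist , ≤-trans d′≤ (+-monoʳ-≤ d 2≤k)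

-- Parallel breadth-first searches

module Exploration {n s K m : ℕ} (code : Code (Fin n × Fin n) K) {X Coord : Set}
                   (d : ℕ) (R : Fin m → Fin n) where

  nextLevel : (Fin m → ℕ) → Graph n → Fin m → ℕ
  nextLevel a H j = Skip.Skipped.level (Skip.skip H d (R j) n (a j))

  -- The number of blocks is fixed in advance, so no bits are spent on announcing the end; a
  -- finished search merely moves its level further past `n`.
  explore : ℕ → (Fin m → ℕ) → Graph n → Protocol s (Graph n × X) Coord (Graph n)
  explore zero    a H = output (λ _ → H)
  explore (suc B) a H =
    round code (expand R b H) H λ H₁ →
    round code (expand R (λ j → 1 + b j) H₁) H₁ λ H₂ →
    round code (expand R (λ j → 2 + b j) H₂) H₂ λ H₃ →
    explore B (λ j → 3 + b j) H₃
    where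
    b : Fin m → ℕ
    b = nextLevel a H

  module _ (D : DistributedGraph n s) (seeds : Fin s → X) (c : Coord) where

    private
      G : Graph n
      G = graph D
      x : Fin s → Graph n × X
      x i = site D i , seeds i

    -- `progress` charges `d` vertices to each of `k` blocks. It counts only to `a j ∸ 2`, as the
    -- next dense vertex may have neighbours from level `a j ∸ 1` on.
    record Invariant (k : ℕ) (a : Fin m → ℕ) (H : Graph n) : Set where
      field
        H⊆G      : H ⊆ᴳ G
        known    : ∀ u → Known G H u ⊎ d ≤ degree H u
        exact    : ∀ j → Exact G H (R j) (a j)
        progress : ∀ j → n ≤ a j ⊎ k * d ≤ reachable H (a j ∸ 2) (R j)

    known-mono : ∀ {H H′} → H ⊆ᴳ H′ → (∀ u → Known G H u ⊎ d ≤ degree H u) →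
                 ∀ u → Known G H′ u ⊎ d ≤ degree H′ u
    known-mono {H} {H′} H⊆H′ known u with known u
    ... | inj₁ all = inj₁ λ v e → H⊆H′ u v (all v e)
    ... | inj₂ deg = inj₂ (≤-trans deg (degree-mono {G = H} {H′} H⊆H′ u))

    exact-round : ∀ {a H} (r : RoundResult code {Out = Graph n} D seeds c (expand R a H) H) →
      (∀ j → Exact G H (R j) (a j)) → ∀ j → Exact G (RoundResult.H′ r) (R j) (suc (a j))
    exact-round {a} {H} r exact j = exact-suc G H⊆H′ (exact j) λ {u} v ru e →
      decidable-stable (reach? H′ (suc (a j)) (R j) v) λ ¬rv → unwanted u v e (j , ru , ¬rv)
      where open RoundResult r

    -- At `suc ∘ a` this is the potential of `expand R a`. It never falls as levels and blackboard
    -- grow, so all rounds share one budget of `m * n` posts.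
    total : (Fin m → ℕ) → Graph n → ℕ
    total a H = sum (λ j → reachable H (a j) (R j))

    total-mono : ∀ {a b H} → (∀ j → a j ≤ b j) → total a H ≤ total b H
    total-mono a≤b = sum-mono-≤ λ j → reachable-mono (λ _ _ e → e) (a≤b j) (R j)

    record Explored (B k : ℕ) (a : Fin m → ℕ) (H : Graph n) : Set where
      field
        H′        : Graph n
        a′        : Fin m → ℕ
        posted    : ℕ
        run       : _↝[_]_ x c (explore B a H) (B * (3 * s) + posted * (1 + K)) (output (λ _ → H′))
        H⊆H′      : H ⊆ᴳ H′
        invariant : Invariant (B + k) a′ H′
        bounded   : posted + total a H ≤ m * n

    explored : ∀ B {k a H} → Invariant k a H → Explored B k a H
    explored zero    {k} {a} {H} inv = record
      { H′ = H ; a′ = a ; posted = 0 ; run = ↝-refl x c ; H⊆H′ = λ _ _ e → e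
      ; invariant = inv ; bounded = sum-≤-const λ j → count≤n (reach? H (a j) (R j)) }
    explored (suc B) {k} {a} {H} inv = record
      { H′        = E.H′
      ; a′        = E.a′
      ; posted    = R₁.posted + (R₂.posted + (R₃.posted + E.posted))
      ; run       = ↝-weaken x c (≤-reflexive (bits-arith s R₁.posted R₂.posted R₃.posted B E.posted K))
                      (↝-trans x c (R₁.run _) (↝-trans x c (R₂.run _) (↝-trans x c (R₃.run _) E.run)))
      ; H⊆H′      = λ u v → E.H⊆H′ u v ∘ H⊆H₃ u v
      ; invariant = subst (λ k′ → Invariant k′ E.a′ E.H′) (+-suc B k) E.invariant
      ; bounded   = begin
          R₁.posted + (R₂.posted + (R₃.posted + E.posted)) + total a H
            ≤⟨ +-monoʳ-≤ (R₁.posted + _) (total-mono {a} {λ j → 1 + b j} {H} λ j → m≤n⇒m≤1+n (a≤b j)) ⟩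
          R₁.posted + (R₂.posted + (R₃.posted + E.posted)) + total (λ j → 1 + b j) H
            ≡⟨ rotate R₁.posted _ _ ⟩
          R₂.posted + (R₃.posted + E.posted) + (R₁.posted + total (λ j → 1 + b j) H)
            ≤⟨ +-monoʳ-≤ (R₂.posted + _) (≤-trans R₁.grown
                 (total-mono {λ j → 1 + b j} {λ j → 2 + b j} {R₁.H′} λ j → n≤1+n _)) ⟩
          R₂.posted + (R₃.posted + E.posted) + total (λ j → 2 + b j) R₁.H′
            ≡⟨ rotate R₂.posted _ _ ⟩
          R₃.posted + E.posted + (R₂.posted + total (λ j → 2 + b j) R₁.H′)
            ≤⟨ +-monoʳ-≤ (R₃.posted + _) (≤-trans R₂.grown
                 (total-mono {λ j → 2 + b j} {λ j → 3 + b j} {R₂.H′} λ j → n≤1+n _)) ⟩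
          R₃.posted + E.posted + total (λ j → 3 + b j) R₂.H′
            ≡⟨ rotate R₃.posted _ _ ⟩
          E.posted + (R₃.posted + total (λ j → 3 + b j) R₂.H′)
            ≤⟨ +-monoʳ-≤ E.posted R₃.grown ⟩
          E.posted + total (λ j → 3 + b j) R₃.H′
            ≤⟨ E.bounded ⟩
          m * n ∎
      }
      where
      open ≤-Reasoning
      open Invariant inv
      b : Fin m → ℕ
      b = nextLevel a H
      module S (j : Fin m) = Skip.Skipped (Skip.skip H d (R j) n (a j))
      a≤b : ∀ j → a j ≤ b j
      a≤b j = S.c≤ j
      r₁ : RoundResult code D seeds c (expand R b H) H
      r₁ = roundResult code D seeds c (expand R b H) (λ _ _ e → e) H⊆G
      module R₁ = RoundResult r₁
      r₂ : RoundResult code D seeds c (expand R (λ j → 1 + b j) R₁.H′) R₁.H′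
      r₂ = roundResult code D seeds c (expand R (λ j → 1 + b j) R₁.H′) (λ _ _ e → e) R₁.H′⊆G
      module R₂ = RoundResult r₂
      r₃ : RoundResult code D seeds c (expand R (λ j → 2 + b j) R₂.H′) R₂.H′
      r₃ = roundResult code D seeds c (expand R (λ j → 2 + b j) R₂.H′) (λ _ _ e → e) R₂.H′⊆G
      module R₃ = RoundResult r₃
      H⊆H₃ : H ⊆ᴳ R₃.H′
      H⊆H₃ u v = R₃.H⊆H′ u v ∘ R₂.H⊆H′ u v ∘ R₁.H⊆H′ u v
      -- The next block starts from level `3 + b j`, and `3 + b j ∸ 2` is the `suc (b j)` of
      -- `dense-reachable`.
      progress′ : ∀ j → n ≤ 3 + b j ⊎ suc k * d ≤ reachable R₃.H′ (suc (b j)) (R j)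
      progress′ j = advance (progress j) (S.stop j)
        where
        level-mono : reachable H (a j ∸ 2) (R j) ≤ reachable H (b j ∸ 2) (R j)
        level-mono = reachable-mono {G = H} {H = H} (λ _ _ e → e) (∸-monoˡ-≤ 2 (a≤b j)) (R j)
        graph-mono : reachable H (suc (b j)) (R j) ≤ reachable R₃.H′ (suc (b j)) (R j)
        graph-mono = reachable-mono {G = H} {H = R₃.H′} H⊆H₃ ≤-refl (R j)
        advance : n ≤ a j ⊎ k * d ≤ reachable H (a j ∸ 2) (R j) →
               Skip.Dense H d (R j) (b j) ⊎ n + a j ≤ b j →
               n ≤ 3 + b j ⊎ suc k * d ≤ reachable R₃.H′ (suc (b j)) (R j)
        advance (inj₁ n≤a)  _            = inj₁ (≤-trans n≤a (≤-trans (a≤b j) (m≤n+m (b j) 3)))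
        advance (inj₂ _)    (inj₂ n+a≤b) = inj₁ (≤-trans (m≤m+n n (a j)) (≤-trans n+a≤b (m≤n+m (b j) 3)))
        advance (inj₂ many) (inj₁ dense) = inj₂ (≤-trans (≤-reflexive (+-comm d (k * d)))
          (≤-trans (+-monoˡ-≤ d (≤-trans many level-mono))
          (≤-trans (Skip.dense-reachable H d (R j) (b j) dense) graph-mono)))
      inv′ : Invariant (suc k) (λ j → 3 + b j) R₃.H′
      inv′ = record
        { H⊆G      = R₃.H′⊆G
        ; known    = known-mono {H} {R₃.H′} H⊆H₃ known
        ; exact    = exact-round r₃ (exact-round r₂ (exact-round r₁ λ j →
                       exact-skip G H⊆G known (a≤b j) (S.sparse j) (exact j)))
        ; progress = progress′
        }
      module E = Explored (explored B inv′)
      bits-arith : ∀ s p₁ p₂ p₃ B p K →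
        (s + p₁ * (1 + K)) + ((s + p₂ * (1 + K)) + ((s + p₃ * (1 + K)) + (B * (3 * s) + p * (1 + K))))
        ≡ (1 + B) * (3 * s) + (p₁ + (p₂ + (p₃ + p))) * (1 + K)
      bits-arith = solve-∀
      rotate : ∀ p q r → p + q + r ≡ q + (p + r)
      rotate = solve-∀

    -- A search short of level `n` would have reached `k * d` vertices, more than there are.
    invariant⇒exact-∞ : ∀ {k a H} → n < k * d → Invariant k a H → ∀ j c′ → Exact G H (R j) c′
    invariant⇒exact-∞ {H = H} n<kd inv j with Invariant.progress inv j
    ... | inj₁ n≤a  = exact-∞ G n≤a (Invariant.exact inv j)
    ... | inj₂ many = contradiction
      (≤-trans n<kd (≤-trans many (count≤n (reach? H _ (R j))))) (<-irrefl refl)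

-- Logarithms and square roots

n≤2*⌈n/2⌉ : ∀ n → n ≤ 2 * ⌈ n /2⌉
n≤2*⌈n/2⌉ n = begin
  n                         ≡⟨ sym (⌊n/2⌋+⌈n/2⌉≡n n) ⟩
  ⌊ n /2⌋ + ⌈ n /2⌉         ≤⟨ +-mono-≤ (⌊n/2⌋≤⌈n/2⌉ n) (m≤m+n ⌈ n /2⌉ 0) ⟩
  ⌈ n /2⌉ + (⌈ n /2⌉ + 0)   ∎
  where open ≤-Reasoning

n≤2^⌈log₂n⌉ : ∀ n → n ≤ 2 ^ ⌈log₂ n ⌉
n≤2^⌈log₂n⌉ = <-rec _ λ where
    0 rec → z≤n
    1 rec → s≤s z≤n
    n@(suc (suc k)) rec → begin
      n                            ≤⟨ n≤2*⌈n/2⌉ n ⟩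
      2 * ⌈ n /2⌉                  ≤⟨ *-monoʳ-≤ 2 (rec (⌈n/2⌉<n k)) ⟩
      2 ^ suc ⌈log₂ ⌈ n /2⌉ ⌉      ≡⟨ cong (λ l → 2 ^ suc l) (⌈log₂⌈n/2⌉⌉≡⌈log₂n⌉∸1 n) ⟩
      2 ^ suc (⌈log₂ n ⌉ ∸ 1)      ≡⟨ cong (2 ^_) (m+[n∸m]≡n (⌈log₂⌉-mono-≤ {2} {n} (s≤s (s≤s z≤n)))) ⟩
      2 ^ ⌈log₂ n ⌉                ∎
  where open ≤-Reasoning

-- The root is given by its predecessor, so that `d` is visibly nonzero when dividing by it.
positiveRoot : ∀ m → ∃ λ e → suc e * suc e ≤ suc m × suc m < (2 + e) * (2 + e)
positiveRoot zero = 0 , s≤s z≤n , s≤s (s≤s z≤n)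
positiveRoot (suc m) with positiveRoot m
... | e , lo , hi with suc (suc m) <? (2 + e) * (2 + e)
... | yes hi′ = e , m≤n⇒m≤1+n lo , hi′
... | no ¬hi′ = suc e , ≮⇒≥ ¬hi′ , (begin-strict
  suc (suc m)       ≤⟨ hi ⟩
  (2 + e) * (2 + e) <⟨ *-mono-< (n<1+n (2 + e)) (n<1+n (2 + e)) ⟩
  (3 + e) * (3 + e) ∎)
  where open ≤-Reasoning

-- Since `Q * d ≤ n` and `s ≤ (d + 2) * d`, the passing bits `Q * s` are at most `3 * (n * d)`. A
-- posted edge costs `1 + (L + L)`: the bit announcing it and its two endpoints.
costBound : ∀ L d n s Q p₁ p₂ → 1 ≤ L → 1 ≤ d → s ≤ (d + 2) * d → Q * d ≤ n →
  p₁ ≤ n * d → p₂ ≤ L * (d + 2) * n →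
  (s + p₁ * (1 + (L + L))) + ((1 + Q) * (3 * s) + p₂ * (1 + (L + L)))
    ≤ 21 * L ^ 2 * s + 21 * L ^ 2 * (n * d)
costBound L d n s Q p₁ p₂ 1≤L 1≤d s≤ Qd≤n p₁≤ p₂≤ = begin
  (s + p₁ * (1 + (L + L))) + ((1 + Q) * (3 * s) + p₂ * (1 + (L + L)))
    ≤⟨ +-mono-≤ (+-monoʳ-≤ s (*-mono-≤ p₁≤ word))
                (+-monoʳ-≤ ((1 + Q) * (3 * s)) (*-mono-≤ p₂≤ word)) ⟩
  (s + n * d * (3 * L)) + ((1 + Q) * (3 * s) + L * (d + 2) * n * (3 * L))
    ≡⟨ eq₁ L d n s Q ⟩
  4 * s + 3 * (Q * s) + 3 * (1 * L * (n * d)) + 3 * (L * L * (n * (d + 2)))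
    ≤⟨ +-mono-≤ (+-mono-≤ (+-monoʳ-≤ (4 * s) (*-monoʳ-≤ 3 Qs))
                  (*-monoʳ-≤ 3 (*-monoˡ-≤ (n * d) (*-monoˡ-≤ L 1≤L))))
                (*-monoʳ-≤ 3 (*-monoʳ-≤ (L * L) (*-monoʳ-≤ n d+2≤))) ⟩
  4 * s + 3 * (3 * (n * d)) + 3 * (L * L * (n * d)) + 3 * (L * L * (n * (3 * d)))
    ≡⟨ eq₂ L d n s ⟩
  1 * (4 * s + 9 * (n * d)) + L * L * (12 * (n * d))
    ≤⟨ +-monoˡ-≤ (L * L * (12 * (n * d))) (*-monoˡ-≤ (4 * s + 9 * (n * d)) (*-mono-≤ 1≤L 1≤L)) ⟩
  L * L * (4 * s + 9 * (n * d)) + L * L * (12 * (n * d))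
    -- The factors 9 and 12 of `n * d` make 21; padding the 4 of `s` by 17 gives both terms the same
    -- polylogarithmic factor.
    ≤⟨ m≤m+n _ (17 * (L * L * s)) ⟩
  L * L * (4 * s + 9 * (n * d)) + L * L * (12 * (n * d)) + 17 * (L * L * s)
    ≡⟨ eq₃ L d n s ⟩
  21 * L ^ 2 * s + 21 * L ^ 2 * (n * d) ∎
  where
  open ≤-Reasoning
  word : 1 + (L + L) ≤ 3 * L
  word = ≤-trans (+-monoˡ-≤ (L + L) 1≤L) (≤-reflexive (cong (λ z → L + (L + z)) (sym (+-identityʳ L))))
  d+2≤ : d + 2 ≤ 3 * d
  d+2≤ = +-monoʳ-≤ d (*-monoʳ-≤ 2 1≤d)
  Qs : Q * s ≤ 3 * (n * d)
  Qs = begin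
    Q * s               ≤⟨ *-monoʳ-≤ Q s≤ ⟩
    Q * ((d + 2) * d)   ≤⟨ *-monoʳ-≤ Q (*-monoˡ-≤ d d+2≤) ⟩
    Q * (3 * d * d)     ≡⟨ eq₀ Q d ⟩
    3 * (Q * d * d)     ≤⟨ *-monoʳ-≤ 3 (*-monoˡ-≤ d Qd≤n) ⟩
    3 * (n * d)         ∎
    where
    eq₀ : ∀ Q d → Q * (3 * d * d) ≡ 3 * (Q * d * d)
    eq₀ = solve-∀
  eq₁ : ∀ L d n s Q → (s + n * d * (3 * L)) + ((1 + Q) * (3 * s) + L * (d + 2) * n * (3 * L))
        ≡ 4 * s + 3 * (Q * s) + 3 * (1 * L * (n * d)) + 3 * (L * L * (n * (d + 2)))
  eq₁ = solve-∀
  eq₂ : ∀ L d n s → 4 * s + 3 * (3 * (n * d)) + 3 * (L * L * (n * d)) + 3 * (L * L * (n * (3 * d)))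
        ≡ 1 * (4 * s + 9 * (n * d)) + L * L * (12 * (n * d))
  eq₂ = solve-∀
  eq₃ : ∀ L d n s → L * L * (4 * s + 9 * (n * d)) + L * L * (12 * (n * d)) + 17 * (L * L * s)
        ≡ 21 * (L * (L * 1)) * s + 21 * (L * (L * 1)) * (n * d)
  eq₃ = solve-∀

-- An integer `d` not exceeding the root of `m` may stand in for it, so the cost analysis stays
-- within the integers.
≤+√-intro : ∀ {t} a b d {m} → t ≤ a + b * d → d * d ≤ m → t ≤ a + b √ m
≤+√-intro {t} a b d {m} t≤ d²≤m = begin
  (t ∸ a) ^ 2    ≤⟨ ^-monoˡ-≤ 2 (m≤n+o⇒m∸n≤o t a t≤) ⟩
  (b * d) ^ 2    ≡⟨ square b d ⟩
  b ^ 2 * (d * d) ≤⟨ *-monoʳ-≤ (b ^ 2) d²≤m ⟩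
  b ^ 2 * m      ∎
  where
  open ≤-Reasoning
  square : ∀ b d → (b * d) * ((b * d) * 1) ≡ b * (b * 1) * (d * d)
  square = solve-∀

-- The complete protocol and its analysis

module SpannerProtocol (n′ s L d Q : ℕ) (n<2^L : suc n′ < 2 ^ L)
                       (n+s≤[d+2]d : suc n′ + s ≤ (d + 2) * d) (n<[1+Q]d : suc n′ < suc Q * d)
                       {X Coord : Set} where

  private
    n : ℕ
    n = suc n′

  code : Code (Fin n × Fin n) (L + L)
  code = pairCode {K = L} {L} (finCode (<⇒≤ n<2^L)) (finCode (<⇒≤ n<2^L))

  module Roots (H : Graph n) where

    hitting : Σ (List (Fin n)) λ R →
      length R ≤ L * (d + 2) × (∀ u → d ≤ degree H u → Any (Adj H u) R)
    -- `d + 2` serves as `q` because `n ≤ (d + 2) * d`, where `d * d` alone can fall short; `L`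
    -- halvings suffice as `n < 2 ^ L`.
    hitting = HittingSet.hittingSet H d (d + 2) (≤-trans (m≤m+n n s) n+s≤[d+2]d) L n<2^L

    roots : List (Fin n)
    roots = proj₁ hitting

    open Exploration {s = s} code {X} {Coord} d (lookup roots) public

  search : Graph n → Protocol s (Graph n × X) Coord (Graph n)
  search H = Roots.explore H (suc Q) (λ _ → 0) H

  protocol : Protocol s (Graph n × X) Coord (Graph n)
  protocol = round code (saturate d) emptyGraph search

  module _ (D : DistributedGraph n s) (seeds : Fin s → X) (c : Coord) where

    private
      G : Graph n
      G = graph D
      x : Fin s → Graph n × X
      x i = site D i , seeds i

    Correct : Set
    Correct = ∀ {k} → 2 ≤ k → IsAdditiveSpanner k G (result protocol x c)

    Cheap : Set
    Cheap = 1 ≤ L → 1 ≤ d → Q * d ≤ n →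
            bits protocol x ≤ 21 * L ^ 2 * s + 21 * L ^ 2 * (n * d)

    module Saturated (r : RoundResult code {Out = Graph n} D seeds c (saturate d) emptyGraph) where

      open RoundResult r renaming (H′ to H; posted to saturating; run to saturation) hiding (H⊆H′)
      open Roots H

      known : ∀ u → Known G H u ⊎ d ≤ degree H u
      known u = [ (λ lt → inj₁ λ v e →
        decidable-stable (Adj? H u v) λ ¬e → unwanted u v e (¬e , lt)) , inj₂ ∘ ≮⇒≥ ]′
        (toSum (degree H u <? d))

      start-invariant : Invariant D seeds c 0 (λ _ → 0) H
      start-invariant = record
        { H⊆G = H′⊆G ; known = known ; exact = λ { j z≤n () } ; progress = λ j → inj₂ z≤n }

      module Searched (e : Explored D seeds c (suc Q) 0 (λ _ → 0) H) where

        open Explored e renaming (H′ to S; run to searching)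

        protocol-↝ : _↝[_]_ x c protocol
          (s + saturating * (1 + (L + L)) + (suc Q * (3 * s) + posted * (1 + (L + L))))
          (output (λ _ → S))
        protocol-↝ = ↝-trans x c (saturation search) searching

        covered : ∀ u → Known G S u ⊎ ∃ λ j → Adj S u (lookup roots j)
        covered u = Sum.map (λ all v e → H⊆H′ u v (all v e))
          (λ deg → let hit = proj₂ (proj₂ hitting) u deg in
            Any.index hit , H⊆H′ u _ (lookup-index hit))
          (known u)

        correct : Correct
        correct {k} 2≤k = subst (IsAdditiveSpanner k G) (sym (_↝[_]_.result-≡ protocol-↝))
          (spanner G (lookup roots) (Invariant.H⊆G invariant) covered
            (invariant⇒exact-∞ D seeds c
              (≤-trans n<[1+Q]d (≤-reflexive (cong (_* d) (sym (+-identityʳ (suc Q)))))) invariant)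
            2≤k)

        cheap : Cheap
        cheap 1≤L 1≤d Qd≤n = begin
          bits protocol x
            ≤⟨ _↝[_]_.bits-≤ protocol-↝ ⟩
          s + saturating * (1 + (L + L)) + (suc Q * (3 * s) + posted * (1 + (L + L))) + 0
            ≡⟨ +-identityʳ _ ⟩
          s + saturating * (1 + (L + L)) + (suc Q * (3 * s) + posted * (1 + (L + L)))
            ≤⟨ costBound L d n s Q saturating posted 1≤L 1≤d (≤-trans (m≤n+m s n) n+s≤[d+2]d) Qd≤n
                 (≤-trans (≤-trans (m≤m+n saturating _) grown) (sum-≤-const λ u → m⊓n≤n (degree H u) d))
                 (≤-trans (≤-trans (m≤m+n posted _) bounded) (*-monoˡ-≤ n (proj₁ (proj₂ hitting)))) ⟩
          21 * L ^ 2 * s + 21 * L ^ 2 * (n * d) ∎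
          where open ≤-Reasoning

        analysed : Correct × Cheap
        analysed = correct , cheap

    analysis : Correct × Cheap
    analysis = analyse (roundResult code D seeds c (saturate d) (λ _ _ ()) (λ _ _ ()))
      where
      analyse : RoundResult code {Out = Graph n} D seeds c (saturate d) emptyGraph → Correct × Cheap
      analyse r = Saturated.Searched.analysed r
        (Roots.explored (RoundResult.H′ r) D seeds c (suc Q) (Saturated.start-invariant r))

-- Choice of the parameters

module Parameters (n′ s : ℕ) where

  n L d : ℕ
  n = suc n′
  L = ⌈log₂ (2 + n + s) ⌉
  d = suc (proj₁ (positiveRoot (n′ + s)))

  1≤L : 1 ≤ L
  1≤L = ⌈log₂⌉-mono-≤ {2} {2 + n + s} (s≤s (s≤s z≤n))

  n<2^L : n < 2 ^ L
  n<2^L = ≤-trans (≤-trans (n≤1+n (suc n)) (m≤m+n (2 + n) s)) (n≤2^⌈log₂n⌉ (2 + n + s))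

  d²≤n+s : d * d ≤ n + s
  d²≤n+s = proj₁ (proj₂ (positiveRoot (n′ + s)))

  -- With `d` the root rounded down, `n + s < (d + 1) ^ 2 = 1 + (d + 2) * d`.
  n+s≤[d+2]d : n + s ≤ (d + 2) * d
  n+s≤[d+2]d = s≤s⁻¹ (≤-trans (proj₂ (proj₂ (positiveRoot (n′ + s))))
                              (≤-reflexive (square (proj₁ (positiveRoot (n′ + s))))))
    where
    square : ∀ e → (2 + e) * (2 + e) ≡ 1 + (1 + e + 2) * (1 + e)
    square = solve-∀

  n<[1+n/d]d : n < suc (n / d) * d
  n<[1+n/d]d = begin-strict
    n                   ≡⟨ m≡m%n+[m/n]*n n d ⟩
    n % d + n / d * d   <⟨ +-monoˡ-< (n / d * d) (m%n<n n d) ⟩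
    d + n / d * d       ∎
    where open ≤-Reasoning

  module Π = SpannerProtocol n′ s L d (n / d) n<2^L n+s≤[d+2]d n<[1+n/d]d

-- Deterministic protocols as randomized ones

module _ {n s : ℕ} (p : Protocol s (Graph n × Fin 1) (Fin 1) (Graph n)) where

  deterministic : RandomizedProtocol n s
  deterministic = record { coins = 0 ; protocol = p }

  module _ (D : DistributedGraph n s) where

    deterministic-correct : (P : Problem) →
      (∀ (seeds : Fin s → Fin 1) c → P (graph D) (result p (λ i → site D i , seeds i) c)) →
      ∀ q → ErrorAtMost1/ q P deterministic D
    deterministic-correct P correct q =
      Subset.⊥ ,
      (λ ω _ → correct _ _) ,
      subst (_≤ outcomes deterministic)
        (sym (trans (cong (q *_) (∣⊥∣≡0 (outcomes deterministic))) (*-zeroʳ q))) z≤n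

    deterministic-cost : (C : ℕ → Set) →
      (∀ (seeds : Fin s → Fin 1) → C (bits p (λ i → site D i , seeds i))) →
      ∀ ω → C (cost deterministic D ω)
    deterministic-cost C cheap ω = cheap _

spannerProtocol : ∀ n s → Protocol s (Graph n × Fin 1) (Fin 1) (Graph n)
spannerProtocol zero    s = output (λ _ → emptyGraph)
spannerProtocol (suc n) s = Parameters.Π.protocol n s

theorem13 : (k : ℕ) → 2 ≤ k → (σ : Setting) →
    CommunicationComplexityÕ σ (IsAdditiveSpanner k)
    (λ n s → s) (λ n s → n) (λ n s → n + s)
-- 21 and 2 come from the factor `21 * L ^ 2` in `costBound`, with `L` the logarithm in `polylog`.
theorem13 k 2≤k σ = 21 , 2 , (λ n s → deterministic (spannerProtocol n s)) , solves , bounded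
  where
  A : ℕ → ℕ → ℕ
  A = polylog 21 2

  solves : SolvesWhp σ (IsAdditiveSpanner k) (λ n s → deterministic (spannerProtocol n s))
  -- The protocol never errs, so one threshold serves every `q`; the value 1 leaves out the empty
  -- vertex set.
  solves q = 1 , λ where
    (suc n) s _ D _ → deterministic-correct (spannerProtocol (suc n) s) D (IsAdditiveSpanner k)
      (λ seeds c → proj₁ (Parameters.Π.analysis n s D seeds c) 2≤k) q

  bounded : ∀ n s (D : DistributedGraph n s) → Admissible σ D → ∀ ω →
    cost (deterministic (spannerProtocol n s)) D ω ≤ A n s * s + A n s * n √ (n + s)
  bounded zero    s D _ ω = ≤+√-intro {t = 0} (A 0 s * s) (A 0 s * 0) 0 z≤n z≤n
  bounded (suc n) s D _ = deterministic-cost (spannerProtocol (suc n) s) D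
    (λ t → t ≤ A (suc n) s * s + A (suc n) s * suc n √ (suc n + s))
    λ seeds → ≤+√-intro (A (suc n) s * s) (A (suc n) s * suc n) d
      (≤-trans (proj₂ (Π.analysis D seeds zero) 1≤L (s≤s z≤n) (m/n*n≤m (suc n) d))
        (≤-reflexive (cong (A (suc n) s * s +_) (sym (*-assoc (A (suc n) s) (suc n) d)))))
      d²≤n+s
    where open Parameters n s hiding (n)
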